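{- Let $x=(x_1,\dots,x_n)\in B^n$ and suppose that its expansion under the multiplicative Selmer algorithm $S$ eventually becomes periodic, i.e. there are $m\geq 0$, $p\geq 1$ with $S^{m+p}x=S^mx$. Then \begin{equation*} \lim_{s\to\infty}\left(\frac{B_1^{(s)}}{B_0^{(s)}},\dots,\frac{B_n^{(s)}}{B_0^{(s)}}\right)=x. \end{equation*} Thus the periodic multiplicative algorithm of Selmer is weakly convergent and even uniformly weakly convergent, i.e. for every column index $g$, $0\leq g\leq n$, the ratios $\left(\frac{B^{(s)}_{1g}}{B^{(s)}_{0g}},\dots,\frac{B^{(s)}_{ng}}{B^{(s)}_{0g}}\right)$ of the entries of $\beta^{(s)}$ converge to $x$ as $s\to\infty$.
   Context: Let $B^n:=\{(x_1,\dots,x_n):\,1\geq x_1\geq\dots\geq x_n\geq 0\}$. The multiplicative Selmer algorithm (MSA) is the map $S\colon B^n\to B^n$, \begin{equation*} S(x_1,\dots,x_n)=\left(\frac{x_2}{x_1},\dots,\frac{x_n}{x_1},\frac{1-kx_n}{x_1}\right),\qquad k=k(x):=\left[x_n^{ -1}\right], \end{equation*} with digit set $\mathbb{N}$ and cells $B(k)=\{x\in B^n:\frac{1}{k+1}<x_n\leq\frac1k\}$. The digits of $x$ are $k_i=k(S^{i-1}x)$, $i\geq 1$. To the digit $k$ one associates the $(n+1)\times(n+1)$-matrix $\beta(k)$ whose first row is $(0,\dots,0,k,1)$ (entry $k$ in the second-to-last column, entry $1$ in the last column), whose entries directly below the main diagonal are $1$, and whose other entries are $0$; it satisfies $\det\beta(k)=\pm1$.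 For $s\geq 1$ put $\beta^{(s)}(k_1,\dots,k_s):=\beta(k_1)\cdots\beta(k_s)=((B^{(s)}_{ij}))_{0\leq i,j\leq n}$, with $\beta^{(0)}$ the identity matrix. Its columns are written as \begin{equation*} \beta^{(s)}=\begin{pmatrix} B_0^{(s-n+1)} & \dots & B_0^{(s-1)} & B_0^{(s)} & B_0^{(s-n)} \\ \vdots & & & & \vdots\\ B_n^{(s-n+1)} & \dots & B_n^{(s-1)} & B_n^{(s)} & B_n^{(s-n)} \end{pmatrix}, \end{equation*} so $B_i^{(s)}$ is the entry in row $i$ and second-to-last column of $\beta^{(s)}$, and $B_i^{(s+1)}=k_{s+1}B_i^{(s-n+1)}+B_i^{(s-n)}$ for $i=0,\dots,n$. If $y=S^sx$ then $x_i=\frac{B_i^{(s-n+1)}+y_1B_i^{(s-n+2)}+\dots+y_{n-1}B_i^{(s)}+y_nB_i^{(s-n)}}{B_0^{(s-n+1)}+y_1B_0^{(s-n+2)}+\dots+y_{n-1}B_0^{(s)}+y_nB_0^{(s-n)}}$, $1\leq i\leq n$. -}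

module Defs where

open import Algebra.Bundles using (CommutativeRing)
open import Algebra.Structures using (IsCommutativeRing)
import Algebra.Properties.Semiring.Mult as Mult
import Algebra.Properties.Semiring.Sum as Sum
open import Data.Bool.Base using (if_then_else_)
open import Data.Empty using (⊥-elim)
open import Data.Fin.Base as Fin using (Fin; zero; suc; inject₁)
open import Data.Fin.Relation.Unary.Top using (view; ‵fromℕ; ‵inject₁)
import Data.Fin.Properties as Fin
open import Data.Nat.Base as ℕ using (ℕ; zero; suc)
open import Data.Nat.GeneralisedArithmetic using (iterate)
import Data.Nat.Properties as ℕ
open import Data.Product.Base using (Σ; ∃; _×_; _,_; proj₁; proj₂)
open import Data.Sum.Base using (inj₁; inj₂)
open import Data.Vec.Functional using (Vector; last)
open import Level using (Level; _⊔_) renaming (suc to lsuc)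
open import Relation.Binary.Core using (Rel)
open import Relation.Binary.PropositionalEquality.Core using (_≢_)
open import Relation.Binary.Structures using (IsDecTotalOrder)
open import Relation.Nullary.Decidable.Core using (does; yes; no)
open import Relation.Nullary.Negation.Core using (¬_)

-- A classical ordered field.  The inverse is a total operation whose value
-- at 0# is left unspecified.
record OrderedField c ℓ₁ ℓ₂ : Set (lsuc (c ⊔ ℓ₁ ⊔ ℓ₂)) where
  infix  4 _≈_ _≤_ _<_
  infixl 6 _+_ _-_
  infixl 7 _*_ _/_
  infix  8 -_
  infix  9 _⁻¹
  field
    Carrier           : Set c
    _≈_               : Rel Carrier ℓ₁
    _≤_               : Rel Carrier ℓ₂
    _+_ _*_           : Carrier → Carrier → Carrier
    -_ _⁻¹            : Carrier → Carrier
    0# 1#             : Carrier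
    isCommutativeRing : IsCommutativeRing _≈_ _+_ _*_ -_ 0# 1#
    isDecTotalOrder   : IsDecTotalOrder _≈_ _≤_
    0≉1               : ¬ (0# ≈ 1#)
    ⁻¹-cong           : ∀ {x y} → x ≈ y → x ⁻¹ ≈ y ⁻¹
    ⁻¹-inverseʳ       : ∀ x → ¬ (x ≈ 0#) → x * x ⁻¹ ≈ 1#
    +-monoˡ-≤         : ∀ z {x y} → x ≤ y → x + z ≤ y + z
    *-nonneg          : ∀ {x y} → 0# ≤ x → 0# ≤ y → 0# ≤ x * y

  commutativeRing : CommutativeRing c ℓ₁
  commutativeRing = record { isCommutativeRing = isCommutativeRing }

  private
    module DTO = IsDecTotalOrder isDecTotalOrder
    module CR  = CommutativeRing commutativeRing

  _<_ : Rel Carrier (ℓ₁ ⊔ ℓ₂)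
  x < y = x ≤ y × ¬ (x ≈ y)

  ≰⇒> : ∀ {x y} → ¬ (x ≤ y) → y < x
  ≰⇒> {x} {y} x≰y with DTO.total x y
  ... | inj₁ x≤y = ⊥-elim (x≰y x≤y)
  ... | inj₂ y≤x = y≤x , λ y≈x → x≰y (DTO.reflexive (CR.sym y≈x))

  _-_ : Carrier → Carrier → Carrier
  x - y = x + - y

  _/_ : Carrier → Carrier → Carrier
  x / y = x * y ⁻¹

  ∣_∣ : Carrier → Carrier
  ∣ x ∣ = if does (0# DTO.≤? x) then x else - x

  fromℕ : ℕ → Carrier
  fromℕ n = n ×ᵣ 1#
    where open Mult CR.semiring renaming (_×_ to _×ᵣ_)

  -- Convergence with respect to the maximum norm.
  Converges : ∀ {n} → (ℕ → Vector Carrier n) → Vector Carrier n → Set _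
  Converges a l = ∀ ε → 0# < ε → ∃ λ N → ∀ s → N ℕ.≤ s → ∀ i → ∣ a s i - l i ∣ < ε

  Cauchy : (ℕ → Carrier) → Set _
  Cauchy a = ∀ ε → 0# < ε → ∃ λ N → ∀ s t → N ℕ.≤ s → N ℕ.≤ t → ∣ a s - a t ∣ < ε

-- The real numbers: classically, an Archimedean and Cauchy complete ordered
-- field exists and is unique up to isomorphism.
record RealField c ℓ₁ ℓ₂ : Set (lsuc (c ⊔ ℓ₁ ⊔ ℓ₂)) where
  field
    orderedField : OrderedField c ℓ₁ ℓ₂

  open OrderedField orderedField public

  field
    archimedean : ∀ x → ∃ λ n → x < fromℕ n
    complete    : ∀ a → Cauchy a → ∃ λ l → Converges {1} (λ s _ → a s) (λ _ → l)

  private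
    module DTO = IsDecTotalOrder isDecTotalOrder

    search : ∀ x n → x < fromℕ n → Σ ℕ λ k → 0# ≤ x → fromℕ k ≤ x × x < fromℕ (suc k)
    search x zero    x<0   = 0 , λ 0≤x → ⊥-elim (proj₂ x<0 (DTO.antisym (proj₁ x<0) 0≤x))
    search x (suc n) x<1+n with fromℕ n DTO.≤? x
    ... | yes n≤x = n , λ _ → n≤x , x<1+n
    ... | no  n≰x = search x n (≰⇒> n≰x)

  -- The integer part of a nonnegative number.
  floor : ∀ x → Σ ℕ λ k → 0# ≤ x → fromℕ k ≤ x × x < fromℕ (suc k)
  floor x = search x (proj₁ (archimedean x)) (proj₂ (archimedean x))

  ⌊_⌋ : Carrier → ℕ
  ⌊ x ⌋ = proj₁ (floor x)

Matrix : ℕ → Set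
Matrix n = Fin n → Fin n → ℕ

identity : ∀ {n} → Matrix n
identity i j = if does (i Fin.≟ j) then 1 else 0

infixl 7 _⊗_
_⊗_ : ∀ {n} → Matrix n → Matrix n → Matrix n
(A ⊗ B) i j = sum λ l → A i l ℕ.* B l j
  where open Sum ℕ.+-*-semiring using (sum)

-- Throughout, the dimension is n = suc r, so that n ≥ 1; matrices have
-- size n + 1 = suc (suc r) and coordinate x₁ is x zero.

lastCol penultCol : ∀ r → Fin (suc (suc r))
lastCol   r = Fin.fromℕ (suc r)
penultCol r = inject₁ (Fin.fromℕ r)

β : ∀ {r} → ℕ → Matrix (suc (suc r))
β {r} k zero    j = if does (j Fin.≟ penultCol r) then k
                    else if does (j Fin.≟ lastCol r) then 1 else 0
β     k (suc i) j = if does (j Fin.≟ inject₁ i) then 1 else 0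

-- β-product k s is β(k 0) ⋯ β(k (s - 1)): digits are numbered from 0 here.
β-product : ∀ {r} → (ℕ → ℕ) → ℕ → Matrix (suc (suc r))
β-product k zero    = identity
β-product k (suc s) = β-product k s ⊗ β (k s)

module Selmer {c ℓ₁ ℓ₂} (ℝ : RealField c ℓ₁ ℓ₂) where
  open RealField ℝ

  InB : ∀ {r} → Vector Carrier (suc r) → Set ℓ₂
  InB {r} x = x zero ≤ 1# × (∀ (i : Fin r) → x (suc i) ≤ x (inject₁ i)) × 0# ≤ last x

  digit : ∀ {r} → Vector Carrier (suc r) → ℕ
  digit x = ⌊ last x ⁻¹ ⌋

  -- Meaningful only where last x > 0 (hence also x₁ > 0 on Bⁿ).
  S : ∀ {r} → Vector Carrier (suc r) → Vector Carrier (suc r)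
  S x i with view i
  ... | ‵inject₁ j = x (suc j) / x zero
  ... | ‵fromℕ     = (1# - fromℕ (digit x) * last x) / x zero

  S^ : ∀ {r} → ℕ → Vector Carrier (suc r) → Vector Carrier (suc r)
  S^ s x = iterate S x s

  -- The digits k₁, k₂, … are all defined, i.e. the algorithm never terminates.
  InfiniteExpansion : ∀ {r} → Vector Carrier (suc r) → Set _
  InfiniteExpansion x = ∀ s → 0# < last (S^ s x)

  EventuallyPeriodic : ∀ {r} → Vector Carrier (suc r) → Set _
  EventuallyPeriodic x =
    InfiniteExpansion x ×
    ∃ λ m → ∃ λ p → 1 ℕ.≤ p × (∀ i → S^ (m ℕ.+ p) x i ≈ S^ m x i)

  β^ : ∀ {r} → Vector Carrier (suc r) → ℕ → Matrix (suc (suc r))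
  β^ x = β-product λ i → digit (S^ i x)

  -- The ratios of column g of β⁽ˢ⁾ to its top entry are defined for all
  -- large s, and converge to x.
  ColumnConverges : ∀ {r} → Vector Carrier (suc r) → Fin (suc (suc r)) → Set _
  ColumnConverges x g =
    (∃ λ N → ∀ s → N ℕ.≤ s → β^ x s zero g ≢ 0) ×
    Converges (λ s i → fromℕ (β^ x s (suc i) g) / fromℕ (β^ x s zero g)) x

  -- The entries of column n - 1 are B₀⁽ˢ⁾, …, Bₙ⁽ˢ⁾.
  WeaklyConvergent : ∀ {r} → Vector Carrier (suc r) → Set _
  WeaklyConvergent {r} x = ColumnConverges x (penultCol r)

  UniformlyWeaklyConvergent : ∀ {r} → Vector Carrier (suc r) → Set _
  UniformlyWeaklyConvergent x = ∀ g → ColumnConverges x g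

module Submission where

-- Put X_s = (1, S^s x) and let D_s be the row vector (B_ig - x_i B_0g)_g of
-- β⁽ˢ⁾.  Then D_s · X_s = 0, D_{s+1} = D_s β(k_{s+1}), and the claim is that
-- D_s is small compared with the first row b_s of β⁽ˢ⁾.  Choose a multiple of
-- the period so long that the product P of the digit matrices over it is
-- positive; along the times differing by this length P and X = X_s stay the
-- same, and X ≤ P_j ≤ (1 + k) X for some k and all columns P_j of P.  Since
-- D_s · P_j = D_s · (P_j - X) and P_j - X ≥ 0, a bound D_s ≤ ε b_s gives
-- D_s · P_j ≤ ε b_s · (P_j - X) ≤ ε (1 - 1/(1 + k)) b_s · P_j.  In between,
-- bounds of the form D_s ≤ ε b_s persist because all the β are nonnegative.
-- The same argument applies to -D_s.

open import Defs
open import Algebra.Bundles using (CommutativeRing)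
import Algebra.Properties.Ring as RingProperties
import Algebra.Properties.Semiring.Mult as Mult
import Algebra.Properties.Semiring.Sum as Sum
import Algebra.Solver.Ring.NaturalCoefficients.Default as Solver
open import Data.Bool.Base using (if_then_else_; true; false)
open import Data.Fin.Base as Fin using (Fin; zero; suc; toℕ; inject₁)
open import Data.Fin.Induction using (<-weakInduction; >-weakInduction)
import Data.Fin.Properties as Fin
open import Data.Fin.Relation.Unary.Top using (View; view; view-fromℕ; view-inject₁; ‵fromℕ; ‵inject₁)
open import Data.Nat.Base as ℕ using (ℕ; zero; suc; z≤n; s≤s)
open import Data.Nat.DivMod using (m≡m%n+[m/n]*n; m%n<n; m*n/n≡m; /-monoˡ-≤)
open import Data.Nat.GeneralisedArithmetic using (iterate)
import Data.Nat.Properties as ℕ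
open import Data.Nat.Tactic.RingSolver using (solve-∀)
open import Data.Product.Base using (∃; _×_; _,_; proj₁; proj₂)
open import Data.Sum.Base using (inj₁; inj₂)
open import Data.Vec.Functional using (Vector; last; removeAt; _∷_)
open import Function.Base using (_∘_)
open import Relation.Binary.Bundles using (DecTotalOrder)
open import Relation.Binary.PropositionalEquality.Core as ≡ using (_≡_; _≢_)
import Relation.Binary.Reasoning.PartialOrder as PosetReasoning
open import Relation.Nullary.Decidable using (dec-true; dec-false)
open import Relation.Nullary.Decidable.Core using (does; yes; no)
open import Relation.Nullary.Negation.Core using (¬_)

-- Each condition is upward closed, so the sum of the finitely many individual thresholds serves for
-- all indices at once.
uniform : ∀ {n ℓ} {Q : Fin n → ℕ → Set ℓ} →
          (∀ i {a b} → a ℕ.≤ b → Q i a → Q i b) →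
          (∀ i → ∃ (Q i)) → ∃ λ N → ∀ i → Q i N
uniform {zero}  mono ∃Q = 0 , λ ()
uniform {suc n} mono ∃Q
  with M , qM ← ∃Q zero
     | N , qN ← uniform (λ i → mono (suc i)) (λ i → ∃Q (suc i))
  = M ℕ.+ N , λ { zero    → mono zero (ℕ.m≤m+n M N) qM
                ; (suc i) → mono (suc i) (ℕ.m≤n+m N M) (qN i) }

-- Entries of the digit matrices and of their products

module ℕ-Sum = Sum ℕ.+-*-semiring

term≤sum : ∀ {n} (f : Vector ℕ n) i → f i ℕ.≤ ℕ-Sum.sum f
term≤sum f zero    = ℕ.m≤m+n _ _
term≤sum f (suc i) = ℕ.≤-trans (term≤sum (λ j → f (suc j)) i) (ℕ.m≤n+m _ _)

⊗-positive : ∀ {n} (A B : Matrix n) {i} l {j} →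
             1 ℕ.≤ A i l → 1 ℕ.≤ B l j → 1 ℕ.≤ (A ⊗ B) i j
⊗-positive A B {i} l {j} 1≤A 1≤B =
  ℕ.≤-trans (ℕ.*-mono-≤ 1≤A 1≤B) (term≤sum (λ l → A i l ℕ.* B l j) l)

identity-diag : ∀ {n} (i : Fin n) → identity i i ≡ 1
identity-diag i rewrite dec-true (i Fin.≟ i) ≡.refl = ≡.refl

β-subdiag : ∀ {r} k (i : Fin (suc r)) → β k (suc i) (inject₁ i) ≡ 1
β-subdiag k i rewrite dec-true (inject₁ i Fin.≟ inject₁ i) ≡.refl = ≡.refl

β-penult : ∀ r k → β {r} k zero (penultCol r) ≡ k
β-penult r k rewrite dec-true (penultCol r Fin.≟ penultCol r) ≡.refl = ≡.refl

β-last : ∀ r k → β {r} k zero (lastCol r) ≡ 1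
β-last r k
  rewrite dec-false (lastCol r Fin.≟ penultCol r) Fin.fromℕ≢inject₁
        | dec-true (lastCol r Fin.≟ lastCol r) ≡.refl = ≡.refl

β-product-cong : ∀ {r} {d e : ℕ → ℕ} → (∀ s → d s ≡ e s) →
                 ∀ s i j → β-product {r} d s i j ≡ β-product e s i j
β-product-cong d≗e zero    i j = ≡.refl
β-product-cong {d = d} {e} d≗e (suc s) i j rewrite d≗e s =
  ℕ-Sum.sum-cong-≗ λ l → ≡.cong (ℕ._* β (e s) l j) (β-product-cong d≗e s i l)

-- The pattern of β(k), k ≥ 1, is that of a digraph with a cycle of length n
-- and one of length n + 1 through the node 0, hence it is primitive.

primitivity : ℕ → ℕ
primitivity n = n ℕ.* n ℕ.+ (n ℕ.+ suc n)

-- Primitivity of the digit matrices, by counting walks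

module _ {r : ℕ} (d : ℕ → ℕ) (1≤d : ∀ s → 1 ℕ.≤ d s) where
  private
    n : ℕ
    n = suc r

    -- Read as: there is a walk of length s from node i to node j, where the move at time s may use
    -- any edge l → j with `β (d s) l j` positive.
    Pos : ℕ → Fin (suc n) → Fin (suc n) → Set
    Pos s i j = 1 ℕ.≤ β-product d s i j

    edge : ∀ s i l j → 1 ℕ.≤ β (d s) l j → Pos s i l → Pos (suc s) i j
    edge s i l j 1≤β p = ⊗-positive (β-product d s) (β (d s)) l p 1≤β

  -- The ones below the diagonal are edges from each node to its predecessor, present for every
  -- digit.
  descend : ∀ e {s i} g h → toℕ g ≡ e ℕ.+ toℕ h → Pos s i g → Pos (e ℕ.+ s) i h
  descend zero    g h g≡h p rewrite Fin.toℕ-injective g≡h = p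
  descend (suc e) {s} {i} (suc g) h g≡ p =
    ≡.subst (λ t → Pos t i h) (ℕ.+-suc e s)
      (descend e (inject₁ g) h (≡.trans (Fin.toℕ-inject₁ g) (ℕ.suc-injective g≡))
        (edge s i (suc g) (inject₁ g) (ℕ.≤-reflexive (≡.sym (β-subdiag (d s) g))) p))

  -- The edge from 0 to n - 1 carries the digit, which is positive; r = n - 1 descents lead back to
  -- 0.
  short-cycle : ∀ {s i} → Pos s i zero → Pos (n ℕ.+ s) i zero
  short-cycle {s} {i} p = ≡.subst (λ t → Pos t i zero) (ℕ.+-suc r s)
    (descend r (penultCol r) zero
      (≡.trans (Fin.toℕ-inject₁ (Fin.fromℕ r)) (≡.trans (Fin.toℕ-fromℕ r) (≡.sym (ℕ.+-identityʳ r))))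
      (edge s i zero (penultCol r) (ℕ.≤-trans (1≤d s) (ℕ.≤-reflexive (≡.sym (β-penult r (d s))))) p))

  -- The edge from 0 to n carries the entry 1; n - j descents follow. For j = 0 this is the cycle of
  -- length n + 1.
  from-zero : ∀ {s i} → Pos s i zero → ∀ j → Pos (suc (n ℕ.∸ toℕ j) ℕ.+ s) i j
  from-zero {s} {i} p j = ≡.subst (λ t → Pos t i j) (ℕ.+-suc (n ℕ.∸ toℕ j) s)
    (descend (n ℕ.∸ toℕ j) (lastCol r) j
      (≡.trans (Fin.toℕ-fromℕ n) (≡.sym (ℕ.m∸n+n≡m (ℕ.s≤s⁻¹ (Fin.toℕ<n j)))))
      (edge s i zero (lastCol r) (ℕ.≤-reflexive (≡.sym (β-last r (d s)))) p))

  -- Of q cycles through 0, v are long and q - v are short, which gives the length v (n + 1) + (q -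
  -- v) n = v + q n.
  cycles : ∀ q {v s i} → v ℕ.≤ q → Pos s i zero → Pos (v ℕ.+ q ℕ.* n ℕ.+ s) i zero
  cycles zero    z≤n p = p
  cycles (suc q) {s = s} {i} (z≤n) p = ≡.subst (λ t → Pos t i zero) (≡.sym (ℕ.+-assoc n (q ℕ.* n) s))
    (short-cycle (cycles q z≤n p))
  cycles (suc q) {suc v} {s} {i} (s≤s v≤q) p =
    ≡.subst (λ t → Pos t i zero) (rearrange n v (q ℕ.* n) s)
      (from-zero (cycles q v≤q p) zero)
    where
    rearrange : ∀ n v w s → suc n ℕ.+ (v ℕ.+ w ℕ.+ s) ≡ suc v ℕ.+ (n ℕ.+ w) ℕ.+ s
    rearrange = solve-∀

  -- Division with remainder writes u as v + q n; from n² ≤ u it follows that v < n ≤ q, so `cycles`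
  -- applies.
  return : ∀ u → n ℕ.* n ℕ.≤ u → ∀ {s i} → Pos s i zero → Pos (u ℕ.+ s) i zero
  return u n²≤u {s} {i} p =
    ≡.subst (λ t → Pos (t ℕ.+ s) i zero) (≡.sym (m≡m%n+[m/n]*n u n))
      (cycles (u ℕ./ n) (ℕ.≤-trans (ℕ.<⇒≤ (m%n<n u n)) n≤u/n) p)
    where
    n≤u/n : n ℕ.≤ u ℕ./ n
    n≤u/n = ≡.subst (ℕ._≤ u ℕ./ n) (m*n/n≡m n n) (/-monoˡ-≤ n n²≤u)

  -- A walk of length s from i to j: a descents to 0, a closed walk of length u at 0, and b steps
  -- from 0 to j. Since a + b is at most n + (n + 1), the bound `primitivity n` leaves u ≥ n² for
  -- `return`.
  β-product-positive : ∀ s → primitivity n ℕ.≤ s → ∀ i j → 1 ℕ.≤ β-product {r} d s i j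
  β-product-positive s T≤s i j = ≡.subst (λ t → Pos t i j) s≡
    (from-zero (return u n²≤u (descend (toℕ i) i zero (≡.sym (ℕ.+-identityʳ _))
      (ℕ.≤-reflexive (≡.sym (identity-diag i))))) j)
    where
    a b u : ℕ
    a = toℕ i
    b = suc (n ℕ.∸ toℕ j)
    u = s ℕ.∸ (a ℕ.+ b)
    a+b≤ : a ℕ.+ b ℕ.≤ n ℕ.+ suc n
    a+b≤ = ℕ.+-mono-≤ (ℕ.s≤s⁻¹ (Fin.toℕ<n i)) (s≤s (ℕ.m∸n≤m n (toℕ j)))
    n²≤u : n ℕ.* n ℕ.≤ u
    n²≤u = ℕ.m+n≤o⇒m≤o∸n (n ℕ.* n) (ℕ.≤-trans (ℕ.+-monoʳ-≤ (n ℕ.* n) a+b≤) T≤s)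
    rearrange : ∀ a b u → b ℕ.+ (u ℕ.+ (a ℕ.+ 0)) ≡ u ℕ.+ (a ℕ.+ b)
    rearrange = solve-∀
    s≡ : b ℕ.+ (u ℕ.+ (a ℕ.+ 0)) ≡ s
    s≡ = ≡.trans (rearrange a b u) (ℕ.m∸n+n≡m
           (ℕ.≤-trans a+b≤ (ℕ.≤-trans (ℕ.m≤n+m _ (n ℕ.* n)) T≤s)))

-- Arithmetic in ordered fields

module OrderedFieldProperties {c ℓ₁ ℓ₂} (F : OrderedField c ℓ₁ ℓ₂) where
  open OrderedField F public

  private
    decTotalOrder : DecTotalOrder c ℓ₁ ℓ₂
    decTotalOrder = record { isDecTotalOrder = isDecTotalOrder }

  open DecTotalOrder decTotalOrder public
    using (poset; total; antisym; _≤?_)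
    renaming (refl to ≤-refl; trans to ≤-trans; reflexive to ≤-reflexive)
  open CommutativeRing commutativeRing public
    using (semiring; commutativeSemiring; ring; +-cong; +-congˡ; +-congʳ; +-comm; +-assoc; +-identityˡ; +-identityʳ;
           *-cong; *-congˡ; *-congʳ; *-comm; *-assoc; *-identityˡ; *-identityʳ;
           zeroˡ; zeroʳ; distribˡ; distribʳ; -‿inverseˡ; -‿inverseʳ; -‿cong)
    renaming (refl to ≈-refl; sym to ≈-sym; trans to ≈-trans; reflexive to ≈-reflexive)
  open RingProperties ring public using (-1*x≈-x; -‿distribˡ-*; -‿involutive)
  open Sum semiring public
    using (sum; sum-cong-≋; ∑-distrib-+; ∑-comm; *-distribˡ-sum; *-distribʳ-sum; sum-remove; sum-replicate-zero)
  open Mult semiring using (×-homo-+; ×1-homo-*)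
  open Solver commutativeSemiring public using (solve; _:=_; _:+_; _:*_)
  open PosetReasoning poset

  ≤⇒≯ : ∀ {x y} → x ≤ y → ¬ (y < x)
  ≤⇒≯ x≤y (y≤x , y≉x) = y≉x (antisym y≤x x≤y)

  <⇒≉0 : ∀ {x} → 0# < x → ¬ (x ≈ 0#)
  <⇒≉0 (_ , 0≉x) = 0≉x ∘ ≈-sym

  <-≤-trans : ∀ {x y z} → x < y → y ≤ z → x < z
  <-≤-trans {x} {y} {z} x<y y≤z = begin-strict x <⟨ x<y ⟩ y ≤⟨ y≤z ⟩ z ∎

  ≤-<-trans : ∀ {x y z} → x ≤ y → y < z → x < z
  ≤-<-trans {x} {y} {z} x≤y y<z = begin-strict x ≤⟨ x≤y ⟩ y <⟨ y<z ⟩ z ∎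

  +-monoʳ-≤ : ∀ z {x y} → x ≤ y → z + x ≤ z + y
  +-monoʳ-≤ z {x} {y} x≤y = begin
    z + x ≈⟨ +-comm z x ⟩
    x + z ≤⟨ +-monoˡ-≤ z x≤y ⟩
    y + z ≈⟨ +-comm y z ⟩
    z + y ∎

  +-mono-≤ : ∀ {x y u v} → x ≤ y → u ≤ v → x + u ≤ y + v
  +-mono-≤ {y = y} {u} x≤y u≤v = ≤-trans (+-monoˡ-≤ u x≤y) (+-monoʳ-≤ y u≤v)

  x-y+y≈x : ∀ x y → x - y + y ≈ x
  x-y+y≈x x y = begin-equality
    x - y + y     ≈⟨ +-assoc x (- y) y ⟩
    x + (- y + y) ≈⟨ +-congˡ (-‿inverseˡ y) ⟩
    x + 0#        ≈⟨ +-identityʳ x ⟩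
    x             ∎

  x+y-y≈x : ∀ x y → x + y - y ≈ x
  x+y-y≈x x y = begin-equality
    x + y - y     ≈⟨ +-assoc x y (- y) ⟩
    x + (y - y)   ≈⟨ +-congˡ (-‿inverseʳ y) ⟩
    x + 0#        ≈⟨ +-identityʳ x ⟩
    x             ∎

  +-cancelʳ-≤ : ∀ z {x y} → x + z ≤ y + z → x ≤ y
  +-cancelʳ-≤ z {x} {y} x+z≤y+z = begin
    x         ≈⟨ x+y-y≈x x z ⟨
    x + z - z ≤⟨ +-monoˡ-≤ (- z) x+z≤y+z ⟩
    y + z - z ≈⟨ x+y-y≈x y z ⟩
    y         ∎

  x≤y⇒0≤y-x : ∀ {x y} → x ≤ y → 0# ≤ y - x
  x≤y⇒0≤y-x {x} {y} x≤y = begin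
    0#    ≈⟨ -‿inverseʳ x ⟨
    x - x ≤⟨ +-monoˡ-≤ (- x) x≤y ⟩
    y - x ∎

  *-monoˡ-≤ : ∀ {z x y} → 0# ≤ z → x ≤ y → z * x ≤ z * y
  *-monoˡ-≤ {z} {x} {y} 0≤z x≤y = begin
    z * x                 ≈⟨ +-identityˡ _ ⟨
    0# + z * x            ≤⟨ +-monoˡ-≤ (z * x) (*-nonneg 0≤z (x≤y⇒0≤y-x x≤y)) ⟩
    z * (y - x) + z * x   ≈⟨ distribˡ z (y - x) x ⟨
    z * (y - x + x)       ≈⟨ *-congˡ (x-y+y≈x y x) ⟩
    z * y                 ∎

  *-monoʳ-≤ : ∀ {z x y} → 0# ≤ z → x ≤ y → x * z ≤ y * z
  *-monoʳ-≤ {z} {x} {y} 0≤z x≤y = begin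
    x * z ≈⟨ *-comm x z ⟩
    z * x ≤⟨ *-monoˡ-≤ 0≤z x≤y ⟩
    z * y ≈⟨ *-comm z y ⟩
    y * z ∎

  -- This is 0 ≤ (x₂ - x₁) * (y₂ - y₁) with the negative terms moved to the left.
  rearrangement : ∀ {x₁ x₂ y₁ y₂} → x₁ ≤ x₂ → y₁ ≤ y₂ → x₁ * y₂ + x₂ * y₁ ≤ x₁ * y₁ + x₂ * y₂
  rearrangement {x₁} {x₂} {y₁} {y₂} x₁≤x₂ y₁≤y₂ = begin
    x₁ * y₂ + x₂ * y₁         ≈⟨ +-congʳ (*-congˡ (x-y+y≈x y₂ y₁)) ⟨
    x₁ * (d + y₁) + x₂ * y₁
      ≈⟨ solve 4 (λ a b d y → a :* (d :+ y) :+ b :* y := a :* d :+ (a :* y :+ b :* y)) ≈-refl x₁ x₂ d y₁ ⟩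
    x₁ * d + (x₁ * y₁ + x₂ * y₁) ≤⟨ +-monoˡ-≤ _ (*-monoʳ-≤ (x≤y⇒0≤y-x y₁≤y₂) x₁≤x₂) ⟩
    x₂ * d + (x₁ * y₁ + x₂ * y₁)
      ≈⟨ solve 4 (λ a b d y → b :* d :+ (a :* y :+ b :* y) := a :* y :+ b :* (d :+ y)) ≈-refl x₁ x₂ d y₁ ⟩
    x₁ * y₁ + x₂ * (d + y₁)   ≈⟨ +-congˡ (*-congˡ (x-y+y≈x y₂ y₁)) ⟩
    x₁ * y₁ + x₂ * y₂         ∎
    where d = y₂ - y₁

  0≤1 : 0# ≤ 1#
  0≤1 with total 0# 1#
  ... | inj₁ 0≤1 = 0≤1
  -- Here -1 is nonnegative, hence so is its square 1.
  ... | inj₂ 1≤0 = begin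
    0#            ≤⟨ *-nonneg 0≤-1 0≤-1 ⟩
    - 1# * - 1#   ≈⟨ -‿distribˡ-* 1# (- 1#) ⟨
    - (1# * - 1#) ≈⟨ -‿cong (*-identityˡ (- 1#)) ⟩
    - (- 1#)      ≈⟨ -‿involutive 1# ⟩
    1#            ∎
    where
    0≤-1 : 0# ≤ - 1#
    0≤-1 = ≤-trans (x≤y⇒0≤y-x 1≤0) (≤-reflexive (+-identityˡ (- 1#)))

  0<1 : 0# < 1#
  0<1 = 0≤1 , 0≉1

  *-cancelˡ-≈ : ∀ {z x y} → ¬ (z ≈ 0#) → z * x ≈ z * y → x ≈ y
  *-cancelˡ-≈ {z} {x} {y} z≉0 zx≈zy = begin-equality
    x              ≈⟨ shrink x ⟨
    z ⁻¹ * (z * x) ≈⟨ *-congˡ zx≈zy ⟩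
    z ⁻¹ * (z * y) ≈⟨ shrink y ⟩
    y              ∎
    where
    shrink : ∀ w → z ⁻¹ * (z * w) ≈ w
    shrink w = begin-equality
      z ⁻¹ * (z * w) ≈⟨ solve 3 (λ z z' w → z' :* (z :* w) := (z :* z') :* w) ≈-refl z (z ⁻¹) w ⟩
      z * z ⁻¹ * w   ≈⟨ *-congʳ (⁻¹-inverseʳ z z≉0) ⟩
      1# * w         ≈⟨ *-identityˡ w ⟩
      w              ∎

  *-cancelˡ-≤ : ∀ {z x y} → 0# < z → z * x ≤ z * y → x ≤ y
  *-cancelˡ-≤ {x = x} {y} 0<z zx≤zy with total x y
  ... | inj₁ x≤y = x≤y
  ... | inj₂ y≤x = ≤-reflexive (*-cancelˡ-≈ (<⇒≉0 0<z) (antisym zx≤zy (*-monoˡ-≤ (proj₁ 0<z) y≤x)))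

  *-monoˡ-< : ∀ {z x y} → 0# < z → x < y → z * x < z * y
  *-monoˡ-< 0<z (x≤y , x≉y) = *-monoˡ-≤ (proj₁ 0<z) x≤y , x≉y ∘ *-cancelˡ-≈ (<⇒≉0 0<z)

  *-cancelˡ-< : ∀ {z x y} → 0# ≤ z → z * x < z * y → x < y
  *-cancelˡ-< {z} {x} {y} 0≤z zx<zy = ≰⇒> λ y≤x → ≤⇒≯ (*-monoˡ-≤ 0≤z y≤x) zx<zy

  x*[y/x]≈y : ∀ {x} y → ¬ (x ≈ 0#) → x * (y / x) ≈ y
  x*[y/x]≈y {x} y x≉0 = begin-equality
    x * (y * x ⁻¹) ≈⟨ solve 3 (λ x x' y → x :* (y :* x') := (x :* x') :* y) ≈-refl x (x ⁻¹) y ⟩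
    x * x ⁻¹ * y   ≈⟨ *-congʳ (⁻¹-inverseʳ x x≉0) ⟩
    1# * y         ≈⟨ *-identityˡ y ⟩
    y              ∎

  ⁻¹-nonneg : ∀ {x} → 0# < x → 0# ≤ x ⁻¹
  ⁻¹-nonneg {x} 0<x = *-cancelˡ-≤ 0<x (begin
    x * 0#   ≈⟨ zeroʳ x ⟩
    0#       ≤⟨ 0≤1 ⟩
    1#       ≈⟨ ⁻¹-inverseʳ x (<⇒≉0 0<x) ⟨
    x * x ⁻¹ ∎)

  ∣∣-< : ∀ {x ε} → x < ε → - x < ε → ∣ x ∣ < ε
  ∣∣-< {x} x<ε -x<ε with does (0# ≤? x)
  ... | true  = x<ε
  ... | false = -x<ε

  fromℕ-+ : ∀ m n → fromℕ (m ℕ.+ n) ≈ fromℕ m + fromℕ n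
  fromℕ-+ = ×-homo-+ 1#

  fromℕ-* : ∀ m n → fromℕ (m ℕ.* n) ≈ fromℕ m * fromℕ n
  fromℕ-* = ×1-homo-*

  fromℕ-1 : fromℕ 1 ≈ 1#
  fromℕ-1 = +-identityʳ 1#

  fromℕ-nonneg : ∀ n → 0# ≤ fromℕ n
  fromℕ-nonneg zero    = ≤-refl
  fromℕ-nonneg (suc n) = ≤-trans (fromℕ-nonneg n)
    (≤-trans (≤-reflexive (≈-sym (+-identityˡ _))) (+-monoˡ-≤ (fromℕ n) 0≤1))

  fromℕ-mono-≤ : ∀ {m n} → m ℕ.≤ n → fromℕ m ≤ fromℕ n
  fromℕ-mono-≤ {n = n} z≤n = fromℕ-nonneg n
  fromℕ-mono-≤ (s≤s m≤n)   = +-monoʳ-≤ 1# (fromℕ-mono-≤ m≤n)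

  1≤fromℕ : ∀ {n} → 1 ℕ.≤ n → 1# ≤ fromℕ n
  1≤fromℕ 1≤n = ≤-trans (≤-reflexive (≈-sym fromℕ-1)) (fromℕ-mono-≤ 1≤n)

  0<fromℕ : ∀ {n} → 1 ℕ.≤ n → 0# < fromℕ n
  0<fromℕ 1≤n = <-≤-trans 0<1 (1≤fromℕ 1≤n)

  -- If n < m, then x < n + 1 ≤ m ≤ x. This is how integer parts are compared.
  fromℕ-cancel-≤ : ∀ {m n x} → fromℕ m ≤ x → x < fromℕ (suc n) → m ℕ.≤ n
  fromℕ-cancel-≤ {m} {n} {x} m≤x x<1+n = ℕ.≮⇒≥ λ n<m →
    ≤⇒≯ (≤-trans (fromℕ-mono-≤ n<m) m≤x) x<1+n

  fromℕ-sum : ∀ {n} (f : Vector ℕ n) → fromℕ (Sum.sum ℕ.+-*-semiring f) ≈ sum (fromℕ ∘ f)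
  fromℕ-sum {zero}  f = ≈-refl
  fromℕ-sum {suc n} f = ≈-trans (fromℕ-+ (f zero) _) (+-congˡ (fromℕ-sum (f ∘ suc)))

  sum-mono-≤ : ∀ {n} {f g : Vector Carrier n} → (∀ i → f i ≤ g i) → sum f ≤ sum g
  sum-mono-≤ {zero}  f≤g = ≤-refl
  sum-mono-≤ {suc n} f≤g = +-mono-≤ (f≤g zero) (sum-mono-≤ (f≤g ∘ suc))

  sum-single : ∀ {n} (f : Vector Carrier n) i → (∀ j → j ≢ i → f j ≈ 0#) → sum f ≈ f i
  sum-single {suc n} f i f≈0 = begin-equality
    sum f                                 ≈⟨ sum-remove {i = i} f ⟩
    f i + sum (removeAt f i) ≈⟨ +-congˡ (sum-cong-≋ λ j → f≈0 _ (Fin.punchInᵢ≢i i j)) ⟩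
    f i + sum {n} (λ _ → 0#)              ≈⟨ +-congˡ (sum-replicate-zero n) ⟩
    f i + 0#                              ≈⟨ +-identityʳ (f i) ⟩
    f i                                   ∎

-- Dot products, the contraction estimate, and sequences driven by digit matrices

module Trajectories {c ℓ₁ ℓ₂} (F : OrderedField c ℓ₁ ℓ₂) where
  open OrderedFieldProperties F
  open PosetReasoning poset

  infixl 7 _∙_
  _∙_ : ∀ {n} → Vector Carrier n → Vector Carrier n → Carrier
  v ∙ w = sum λ l → v l * w l

  ∙-cong : ∀ {n} {v v′ w w′ : Vector Carrier n} →
           (∀ l → v l ≈ v′ l) → (∀ l → w l ≈ w′ l) → v ∙ w ≈ v′ ∙ w′
  ∙-cong v≈v′ w≈w′ = sum-cong-≋ λ l → *-cong (v≈v′ l) (w≈w′ l)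

  ∙-scaleˡ : ∀ {n} u (v w : Vector Carrier n) → (λ l → u * v l) ∙ w ≈ u * (v ∙ w)
  ∙-scaleˡ u v w = begin-equality
    sum (λ l → u * v l * w l)   ≈⟨ sum-cong-≋ (λ l → *-assoc u (v l) (w l)) ⟩
    sum (λ l → u * (v l * w l)) ≈⟨ *-distribˡ-sum u (λ l → v l * w l) ⟨
    u * (v ∙ w)                 ∎

  ∙-scaleʳ : ∀ {n} u (v w : Vector Carrier n) → v ∙ (λ l → u * w l) ≈ u * (v ∙ w)
  ∙-scaleʳ u v w = ≈-trans
    (sum-cong-≋ λ l → solve 3 (λ u v w → v :* (u :* w) := u :* v :* w) ≈-refl u (v l) (w l))
    (∙-scaleˡ u v w)

  ∙-linearˡ : ∀ {n} u u′ (v v′ w : Vector Carrier n) →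
              (λ l → u * v l + u′ * v′ l) ∙ w ≈ u * (v ∙ w) + u′ * (v′ ∙ w)
  ∙-linearˡ u u′ v v′ w = begin-equality
    sum (λ l → (u * v l + u′ * v′ l) * w l)          ≈⟨ sum-cong-≋ (λ l → distribʳ (w l) _ _) ⟩
    sum (λ l → u * v l * w l + u′ * v′ l * w l)
      ≈⟨ ∑-distrib-+ (λ l → u * v l * w l) (λ l → u′ * v′ l * w l) ⟩
    (λ l → u * v l) ∙ w + (λ l → u′ * v′ l) ∙ w      ≈⟨ +-cong (∙-scaleˡ u v w) (∙-scaleˡ u′ v′ w) ⟩
    u * (v ∙ w) + u′ * (v′ ∙ w)                      ∎

  ∙-assoc : ∀ {m n} (v : Vector Carrier m) (A : Fin m → Vector Carrier n) w →
            (λ j → v ∙ λ l → A l j) ∙ w ≈ v ∙ λ l → A l ∙ w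
  ∙-assoc v A w = begin-equality
    sum (λ j → sum (λ l → v l * A l j) * w j)
      ≈⟨ sum-cong-≋ (λ j → *-distribʳ-sum (w j) (λ l → v l * A l j)) ⟩
    sum (λ j → sum (λ l → v l * A l j * w j))   ≈⟨ ∑-comm (λ j l → v l * A l j * w j) ⟩
    sum (λ l → sum (λ j → v l * A l j * w j))   ≈⟨ sum-cong-≋ (λ l → ∙-scaleˡ (v l) (A l) w) ⟩
    sum (λ l → v l * (A l ∙ w))                 ∎

  ∙-monoʳ-≤ : ∀ {n} {v w w′ : Vector Carrier n} →
              (∀ l → 0# ≤ v l) → (∀ l → w l ≤ w′ l) → v ∙ w ≤ v ∙ w′
  ∙-monoʳ-≤ 0≤v w≤w′ = sum-mono-≤ λ l → *-monoˡ-≤ (0≤v l) (w≤w′ l)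

  ∙-monoˡ-≤ : ∀ {n} {v v′ w : Vector Carrier n} →
              (∀ l → 0# ≤ w l) → (∀ l → v l ≤ v′ l) → v ∙ w ≤ v′ ∙ w
  ∙-monoˡ-≤ 0≤w v≤v′ = sum-mono-≤ λ l → *-monoʳ-≤ (0≤w l) (v≤v′ l)

  indicator-∙ : ∀ {n} (a : Vector ℕ n) w i k → (∀ j → j ≢ i → a j ≡ 0) → a i ≡ k →
                (fromℕ ∘ a) ∙ w ≈ fromℕ k * w i
  indicator-∙ a w i k a≡0 ≡.refl = sum-single (λ j → fromℕ (a j) * w j) i λ j j≢i →
    ≈-trans (*-congʳ (≈-reflexive (≡.cong fromℕ (a≡0 j j≢i)))) (zeroˡ (w j))

  unit-∙ : ∀ {n} (a : Vector ℕ n) w i → (∀ j → j ≢ i → a j ≡ 0) → a i ≡ 1 →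
           (fromℕ ∘ a) ∙ w ≈ w i
  unit-∙ a w i a≡0 a≡1 = begin-equality
    (fromℕ ∘ a) ∙ w ≈⟨ indicator-∙ a w i 1 a≡0 a≡1 ⟩
    fromℕ 1 * w i   ≈⟨ *-congʳ fromℕ-1 ⟩
    1# * w i        ≈⟨ *-identityˡ (w i) ⟩
    w i             ∎

  identity-∙ : ∀ {n} (w : Vector Carrier n) i → (λ j → fromℕ (identity i j)) ∙ w ≈ w i
  identity-∙ w i = unit-∙ (identity i) w i
    (λ j j≢i → ≡.cong (if_then 1 else 0) (dec-false (i Fin.≟ j) (j≢i ∘ ≡.sym))) (identity-diag i)

  ∙-identity : ∀ {n} (w : Vector Carrier n) j → w ∙ (λ l → fromℕ (identity l j)) ≈ w j
  ∙-identity w j = ≈-trans (sum-cong-≋ λ l → *-comm (w l) (fromℕ (identity l j)))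
    (unit-∙ (λ l → identity l j) w j
      (λ l l≢j → ≡.cong (if_then 1 else 0) (dec-false (l Fin.≟ j) l≢j)) (identity-diag j))

  β-suc-∙ : ∀ {r} k w (i : Fin (suc r)) → (λ j → fromℕ (β k (suc i) j)) ∙ w ≈ w (inject₁ i)
  β-suc-∙ k w i = unit-∙ (β k (suc i)) w (inject₁ i)
    (λ j j≢i → ≡.cong (if_then 1 else 0) (dec-false (j Fin.≟ inject₁ i) j≢i)) (β-subdiag k i)

  β-zero-∙ : ∀ r k w → (λ j → fromℕ (β {r} k zero j)) ∙ w ≈ fromℕ k * w (penultCol r) + w (lastCol r)
  β-zero-∙ r k w = begin-equality
    (λ j → fromℕ (β k zero j)) ∙ w ≈⟨ sum-cong-≋ split ⟩
    sum (λ j → fromℕ (a j) * w j + fromℕ (b j) * w j)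
      ≈⟨ ∑-distrib-+ (λ j → fromℕ (a j) * w j) (λ j → fromℕ (b j) * w j) ⟩
    (fromℕ ∘ a) ∙ w + (fromℕ ∘ b) ∙ w
      ≈⟨ +-cong (indicator-∙ a w p k a≡0 a≡k) (unit-∙ b w q b≡0 b≡1) ⟩
    fromℕ k * w p + w q ∎
    where
    p = penultCol r
    q = lastCol r
    a b : Vector ℕ (suc (suc r))
    a j = if does (j Fin.≟ p) then k else 0
    b j = if does (j Fin.≟ q) then 1 else 0
    a≡0 : ∀ j → j ≢ p → a j ≡ 0
    a≡0 j j≢p = ≡.cong (if_then k else 0) (dec-false (j Fin.≟ p) j≢p)
    a≡k : a p ≡ k
    a≡k = ≡.cong (if_then k else 0) (dec-true (p Fin.≟ p) ≡.refl)
    b≡0 : ∀ j → j ≢ q → b j ≡ 0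
    b≡0 j j≢q = ≡.cong (if_then 1 else 0) (dec-false (j Fin.≟ q) j≢q)
    b≡1 : b q ≡ 1
    b≡1 = ≡.cong (if_then 1 else 0) (dec-true (q Fin.≟ q) ≡.refl)
    β≡a+b : ∀ j → β k zero j ≡ a j ℕ.+ b j
    β≡a+b j with j Fin.≟ p
    -- The two special columns are distinct, so at `p` the second indicator contributes nothing.
    ... | yes ≡.refl rewrite b≡0 p (Fin.fromℕ≢inject₁ ∘ ≡.sym) = ≡.sym (ℕ.+-identityʳ k)
    ... | no  _      = ≡.refl
    split : ∀ j → fromℕ (β k zero j) * w j ≈ fromℕ (a j) * w j + fromℕ (b j) * w j
    split j = begin-equality
      fromℕ (β k zero j) * w j             ≈⟨ *-congʳ (≈-reflexive (≡.cong fromℕ (β≡a+b j))) ⟩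
      fromℕ (a j ℕ.+ b j) * w j            ≈⟨ *-congʳ (fromℕ-+ (a j) (b j)) ⟩
      (fromℕ (a j) + fromℕ (b j)) * w j    ≈⟨ distribʳ (w j) (fromℕ (a j)) (fromℕ (b j)) ⟩
      fromℕ (a j) * w j + fromℕ (b j) * w j ∎

  ⊗-∙ : ∀ {n} (A B : Matrix n) i j →
        fromℕ ((A ⊗ B) i j) ≈ (λ l → fromℕ (A i l)) ∙ λ l → fromℕ (B l j)
  ⊗-∙ A B i j = ≈-trans (fromℕ-sum λ l → A i l ℕ.* B l j) (sum-cong-≋ λ l → fromℕ-* (A i l) (B l j))

  -- Replacing P by P - y takes away at least the fraction 1/(1 + k) of b ∙ P,
  -- but nothing of v ∙ P.
  contraction : ∀ {n} (P : Fin n → Carrier) {k} (y b v : Vector Carrier n) {τ C} →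
                (∀ l → y l ≤ P l) → (∀ l → P l ≤ fromℕ (suc k) * y l) →
                (∀ l → 0# ≤ b l) → v ∙ y ≈ 0# → 0# ≤ C →
                (∀ l → τ * v l ≤ C * b l) →
                fromℕ (suc k) * (τ * (v ∙ P)) ≤ fromℕ k * (C * (b ∙ P))
  contraction P {k} y b v {τ} {C} y≤P P≤Ky 0≤b v∙y≈0 0≤C τv≤Cb =
    -- Adding `C * (b ∙ P)` turns the factor k on the right into K = 1 + k and avoids subtraction;
    -- on the left it is estimated by `b∙P≤`.
    +-cancelʳ-≤ (C * (b ∙ P)) (begin
      K * (τ * (v ∙ P)) + C * (b ∙ P)                ≤⟨ +-monoʳ-≤ _ (*-monoˡ-≤ 0≤C b∙P≤) ⟩
      K * (τ * (v ∙ P)) + C * (K * (b ∙ y))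
        ≈⟨ solve 4 (λ K x C z → K :* x :+ C :* (K :* z) := K :* (x :+ C :* z)) ≈-refl K (τ * (v ∙ P)) C (b ∙ y) ⟩
      K * (τ * (v ∙ P) + C * (b ∙ y))                ≤⟨ *-monoˡ-≤ (fromℕ-nonneg (suc k)) main ⟩
      K * (C * (b ∙ P))                              ≈⟨ distribʳ (C * (b ∙ P)) 1# (fromℕ k) ⟩
      1# * (C * (b ∙ P)) + fromℕ k * (C * (b ∙ P))   ≈⟨ +-congʳ (*-identityˡ _) ⟩
      C * (b ∙ P) + fromℕ k * (C * (b ∙ P))          ≈⟨ +-comm _ _ ⟩
      fromℕ k * (C * (b ∙ P)) + C * (b ∙ P)          ∎)
    where
    K = fromℕ (suc k)
    b∙P≤ : b ∙ P ≤ K * (b ∙ y)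
    b∙P≤ = ≤-trans (∙-monoʳ-≤ 0≤b P≤Ky) (≤-reflexive (∙-scaleʳ K b y))
    main : τ * (v ∙ P) + C * (b ∙ y) ≤ C * (b ∙ P)
    main = begin
      τ * (v ∙ P) + C * (b ∙ y)
        ≈⟨ +-cong (∙-scaleˡ τ v P) (∙-scaleˡ C b y) ⟨
      (λ l → τ * v l) ∙ P + (λ l → C * b l) ∙ y
        ≈⟨ ∑-distrib-+ (λ l → τ * v l * P l) (λ l → C * b l * y l) ⟨
      sum (λ l → τ * v l * P l + C * b l * y l)
        -- Termwise this is 0 ≤ (C b - τ v)(P - y); orthogonality of v and y then removes one term
        -- of the result.
        ≤⟨ sum-mono-≤ (λ l → rearrangement (τv≤Cb l) (y≤P l)) ⟩
      sum (λ l → τ * v l * y l + C * b l * P l)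
        ≈⟨ ∑-distrib-+ (λ l → τ * v l * y l) (λ l → C * b l * P l) ⟩
      (λ l → τ * v l) ∙ y + (λ l → C * b l) ∙ P
        ≈⟨ +-cong (∙-scaleˡ τ v y) (∙-scaleˡ C b P) ⟩
      τ * (v ∙ y) + C * (b ∙ P)
        ≈⟨ +-congʳ (≈-trans (*-congˡ v∙y≈0) (zeroʳ τ)) ⟩
      0# + C * (b ∙ P)                                     ≈⟨ +-identityˡ _ ⟩
      C * (b ∙ P)                                          ∎

  -- Since (1 - 1/(1 + k)) / t ≤ 1 / (1 + t) for t ≥ k, a contraction by the factor
  -- 1 - 1/(1 + k) in every step gives a decay like C / t, without powers.
  harmonic-step : ∀ {k t x z} → 1 ℕ.≤ k → k ℕ.≤ t → 0# ≤ z →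
                  fromℕ (suc k) * (fromℕ t * x) ≤ fromℕ k * z →
                  fromℕ (suc t) * x ≤ z
  harmonic-step {k} {t} {x} {z} 1≤k k≤t 0≤z Ktx≤kz with total 0# x
  ... | inj₂ x≤0 = begin
    fromℕ (suc t) * x  ≤⟨ *-monoˡ-≤ (fromℕ-nonneg (suc t)) x≤0 ⟩
    fromℕ (suc t) * 0# ≈⟨ zeroʳ _ ⟩
    0#                 ≤⟨ 0≤z ⟩
    z                  ∎
  -- After multiplication by k the claim follows from k (1 + t) ≤ (1 + k) t, which is just k ≤ t.
  ... | inj₁ 0≤x = *-cancelˡ-≤ (0<fromℕ 1≤k) (begin
    fromℕ k * (fromℕ (suc t) * x)        ≈⟨ *-assoc _ _ x ⟨
    fromℕ k * fromℕ (suc t) * x          ≈⟨ *-congʳ (fromℕ-* k (suc t)) ⟨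
    fromℕ (k ℕ.* suc t) * x              ≤⟨ *-monoʳ-≤ 0≤x (fromℕ-mono-≤ k+kt≤t+kt) ⟩
    fromℕ (suc k ℕ.* t) * x              ≈⟨ *-congʳ (fromℕ-* (suc k) t) ⟩
    fromℕ (suc k) * fromℕ t * x          ≈⟨ *-assoc _ _ x ⟩
    fromℕ (suc k) * (fromℕ t * x)        ≤⟨ Ktx≤kz ⟩
    fromℕ k * z                          ∎)
    where
    k+kt≤t+kt : k ℕ.* suc t ℕ.≤ suc k ℕ.* t
    k+kt≤t+kt = ℕ.≤-trans (ℕ.≤-reflexive (ℕ.*-suc k t)) (ℕ.+-monoˡ-≤ (k ℕ.* t) k≤t)

  module _ {r : ℕ} (d : ℕ → ℕ) where

    -- The recursion satisfied by the rows of β⁽ˢ⁾, stated for field-valued vectors so that it also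
    -- covers linear combinations of rows.
    IsTrajectory : (ℕ → Vector Carrier (suc (suc r))) → Set ℓ₁
    IsTrajectory D = ∀ s j → D (suc s) j ≈ D s ∙ λ l → fromℕ (β (d s) l j)

    row : Fin (suc (suc r)) → ℕ → Vector Carrier (suc (suc r))
    row i s j = fromℕ (β-product d s i j)

    row-isTrajectory : ∀ i → IsTrajectory (row i)
    row-isTrajectory i s j = ⊗-∙ (β-product d s) (β (d s)) i j

    linear-isTrajectory : ∀ u u′ {D D′} → IsTrajectory D → IsTrajectory D′ →
                          IsTrajectory λ s j → u * D s j + u′ * D′ s j
    linear-isTrajectory u u′ {D} {D′} trD trD′ s j =
      ≈-trans (+-cong (*-congˡ (trD s j)) (*-congˡ (trD′ s j)))
              (≈-sym (∙-linearˡ u u′ (D s) (D′ s) λ l → fromℕ (β (d s) l j)))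

    -- The recursion is unrolled over L steps. With the digits shifted by s, the transition matrix
    -- is again a `β-product`, to which positivity and periodicity apply.
    trajectory-block : ∀ {D} → IsTrajectory D → ∀ s L j →
                       D (s ℕ.+ L) j ≈ D s ∙ λ l → fromℕ (β-product (λ i → d (s ℕ.+ i)) L l j)
    trajectory-block {D} trD s zero    j rewrite ℕ.+-identityʳ s = ≈-sym (∙-identity (D s) j)
    trajectory-block {D} trD s (suc L) j rewrite ℕ.+-suc s L = begin-equality
      D (suc (s ℕ.+ L)) j                                 ≈⟨ trD (s ℕ.+ L) j ⟩
      D (s ℕ.+ L) ∙ b
        ≈⟨ ∙-cong {w = b} (trajectory-block {D} trD s L) (λ _ → ≈-refl) ⟩
      (λ i → D s ∙ λ l → fromℕ (P l i)) ∙ b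
        ≈⟨ ∙-assoc (D s) (λ l i → fromℕ (P l i)) b ⟩
      (D s ∙ λ l → (λ i → fromℕ (P l i)) ∙ b)
        ≈⟨ ∙-cong {v = D s} (λ _ → ≈-refl) (λ l → ⊗-∙ P (β (d (s ℕ.+ L))) l j) ⟨
      (D s ∙ λ l → fromℕ ((P ⊗ β (d (s ℕ.+ L))) l j))     ∎
      where
      P : Matrix (suc (suc r))
      P = β-product (λ i → d (s ℕ.+ i)) L
      b : Vector Carrier (suc (suc r))
      b i = fromℕ (β (d (s ℕ.+ L)) i j)

    -- The digit matrices are nonnegative, so multiplying by them preserves the inequality. This
    -- carries bounds from the block times to all later times.
    trajectory-mono : ∀ {D B} → IsTrajectory D → IsTrajectory B → ∀ {τ C} e s →
                      (∀ g → τ * D s g ≤ C * B s g) →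
                      ∀ g → τ * D (e ℕ.+ s) g ≤ C * B (e ℕ.+ s) g
    trajectory-mono trD trB zero    s τD≤CB = τD≤CB
    trajectory-mono {D} {B} trD trB {τ} {C} (suc e) s τD≤CB g = begin
      τ * D (suc (e ℕ.+ s)) g             ≈⟨ *-congˡ (trD (e ℕ.+ s) g) ⟩
      τ * (D (e ℕ.+ s) ∙ b)               ≈⟨ ∙-scaleˡ τ (D (e ℕ.+ s)) b ⟨
      (λ l → τ * D (e ℕ.+ s) l) ∙ b
        ≤⟨ ∙-monoˡ-≤ (λ l → fromℕ-nonneg (β (d (e ℕ.+ s)) l g)) (trajectory-mono {D} {B} trD trB e s τD≤CB) ⟩
      (λ l → C * B (e ℕ.+ s) l) ∙ b       ≈⟨ ∙-scaleˡ C (B (e ℕ.+ s)) b ⟩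
      C * (B (e ℕ.+ s) ∙ b)               ≈⟨ *-congˡ (trB (e ℕ.+ s) g) ⟨
      C * B (suc (e ℕ.+ s)) g             ∎
      where
      b : Vector Carrier (suc (suc r))
      b l = fromℕ (β (d (e ℕ.+ s)) l g)

-- `iterate` applies `f` to the starting value first, whereas induction along an orbit needs the
-- newest application outermost.
iterate-suc : ∀ {a} {A : Set a} (f : A → A) x s → iterate f x (suc s) ≡ f (iterate f x s)
iterate-suc f x zero    = ≡.refl
iterate-suc f x (suc s) = iterate-suc f (f x) s

-- The Selmer map, its digits and its inverse branches

module SelmerProperties {c ℓ₁ ℓ₂} (ℝ : RealField c ℓ₁ ℓ₂) where
  open RealField ℝ using (orderedField; archimedean; floor)
  open OrderedFieldProperties orderedField
  open Trajectories orderedField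
  open Selmer ℝ
  open PosetReasoning poset

  archimedean-* : ∀ x {y} → 0# < y → ∃ λ n → x < fromℕ n * y
  archimedean-* x {y} 0<y with n , x/y<n ← archimedean (x / y) = n , (begin-strict
    x           ≈⟨ x*[y/x]≈y x (<⇒≉0 0<y) ⟨
    y * (x / y) <⟨ *-monoˡ-< 0<y x/y<n ⟩
    y * fromℕ n ≈⟨ *-comm y (fromℕ n) ⟩
    fromℕ n * y ∎)

  -- The homogeneous coordinates (1, x₁, …, xₙ).
  ext : ∀ {r} → Vector Carrier (suc r) → Vector Carrier (suc (suc r))
  ext x = 1# ∷ x

  -- The leading coordinate 1 absorbs the condition x₁ ≤ 1 into the chain; positivity of xₙ is
  -- carried separately.
  Decreasing : ∀ {r} → Vector Carrier (suc r) → Set ℓ₂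
  Decreasing x = ∀ j → ext x (suc j) ≤ ext x (inject₁ j)

  InB⇒Decreasing : ∀ {r} {x : Vector Carrier (suc r)} → InB x → Decreasing x
  InB⇒Decreasing (x₁≤1 , dec , _) zero    = x₁≤1
  InB⇒Decreasing (x₁≤1 , dec , _) (suc i) = dec i

  module _ {r} {x : Vector Carrier (suc r)} (dec : Decreasing x) where

    ext≤1 : ∀ l → ext x l ≤ 1#
    ext≤1 = <-weakInduction (λ l → ext x l ≤ 1#) ≤-refl λ j → ≤-trans (dec j)

    ext-positive : 0# < last x → ∀ l → 0# < ext x l
    ext-positive 0<xₙ = >-weakInduction (λ l → 0# < ext x l) 0<xₙ λ j 0<x → <-≤-trans 0<x (dec j)

  digit-floor : ∀ {r} {x : Vector Carrier (suc r)} → 0# < last x →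
                fromℕ (digit x) ≤ last x ⁻¹ × last x ⁻¹ < fromℕ (suc (digit x))
  digit-floor {x = x} 0<xₙ = proj₂ (floor (last x ⁻¹)) (⁻¹-nonneg 0<xₙ)

  -- The digit comes from a search below an Archimedean bound, and that bound need not respect `≈`.
  -- The two inequalities of the integer part determine the result nevertheless.
  digit-cong-≤ : ∀ {r} {x y : Vector Carrier (suc r)} → 0# < last x → 0# < last y →
                 last x ≈ last y → digit x ℕ.≤ digit y
  digit-cong-≤ {x = x} {y} 0<xₙ 0<yₙ xₙ≈yₙ =
    fromℕ-cancel-≤ (≤-trans (proj₁ (digit-floor {x = x} 0<xₙ)) (≤-reflexive (⁻¹-cong xₙ≈yₙ)))
                   (proj₂ (digit-floor {x = y} 0<yₙ))

  digit-cong : ∀ {r} {x y : Vector Carrier (suc r)} → 0# < last x → 0# < last y →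
               last x ≈ last y → digit x ≡ digit y
  digit-cong {x = x} {y} 0<xₙ 0<yₙ xₙ≈yₙ = ℕ.≤-antisym
    (digit-cong-≤ {x = x} {y} 0<xₙ 0<yₙ xₙ≈yₙ)
    (digit-cong-≤ {x = y} {x} 0<yₙ 0<xₙ (≈-sym xₙ≈yₙ))

  1≤digit : ∀ {r} {x : Vector Carrier (suc r)} → 0# < last x → last x ≤ 1# → 1 ℕ.≤ digit x
  1≤digit {x = x} 0<xₙ xₙ≤1 = fromℕ-cancel-≤ (*-cancelˡ-≤ 0<xₙ (begin
    last x * fromℕ 1   ≈⟨ *-congˡ fromℕ-1 ⟩
    last x * 1#        ≈⟨ *-identityʳ _ ⟩
    last x             ≤⟨ xₙ≤1 ⟩
    1#                 ≈⟨ ⁻¹-inverseʳ (last x) (<⇒≉0 0<xₙ) ⟨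
    last x * last x ⁻¹ ∎)) (proj₂ (digit-floor {x = x} 0<xₙ))

  S-cong : ∀ {r} {x y : Vector Carrier (suc r)} → 0# < last x → 0# < last y →
           (∀ i → x i ≈ y i) → ∀ i → S x i ≈ S y i
  S-cong {x = x} {y} 0<xₙ 0<yₙ x≈y i with view i
  ... | ‵inject₁ j = *-cong (x≈y (suc j)) (⁻¹-cong (x≈y zero))
  ... | ‵fromℕ     = *-cong
    (+-congˡ (-‿cong (*-cong (≈-reflexive (≡.cong fromℕ (digit-cong {x = x} {y} 0<xₙ 0<yₙ (x≈y _)))) (x≈y _))))
    (⁻¹-cong (x≈y zero))

  S-inject₁ : ∀ {r} (x : Vector Carrier (suc r)) j → S x (inject₁ j) ≡ x (suc j) / x zero
  S-inject₁ x j rewrite view-inject₁ j = ≡.refl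

  S-last : ∀ {r} (x : Vector Carrier (suc r)) →
           S x (Fin.fromℕ r) ≡ (1# - fromℕ (digit x) * last x) / x zero
  S-last {r} x rewrite view-fromℕ r = ≡.refl

  module _ {r} (x : Vector Carrier (suc r)) (0<x₁ : 0# < x zero) where

    S-inject₁-scaled : ∀ i → x zero * ext (S x) (inject₁ i) ≈ ext x (suc i)
    S-inject₁-scaled zero    = *-identityʳ (x zero)
    S-inject₁-scaled (suc j) = ≈-trans (*-congˡ (≈-reflexive (S-inject₁ x j)))
                                 (x*[y/x]≈y (x (suc j)) (<⇒≉0 0<x₁))

    S-last-scaled : x zero * last (S x) ≈ 1# - fromℕ (digit x) * last x
    S-last-scaled = ≈-trans (*-congˡ (≈-reflexive (S-last x))) (x*[y/x]≈y _ (<⇒≉0 0<x₁))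

    -- β(k) undoes `S` in homogeneous coordinates up to the factor x₁: the lower rows shift the
    -- coordinates back, and the first row recovers 1 as (1 - k xₙ) + k xₙ.
    β-ext : ∀ l → x zero * ((λ j → fromℕ (β (digit x) l j)) ∙ ext (S x)) ≈ ext x l
    β-ext (suc i) = ≈-trans (*-congˡ (β-suc-∙ (digit x) (ext (S x)) i)) (S-inject₁-scaled i)
    β-ext zero    = begin-equality
      x zero * ((λ j → fromℕ (β (digit x) zero j)) ∙ ext (S x))
        ≈⟨ *-congˡ (β-zero-∙ r (digit x) (ext (S x))) ⟩
      x zero * (k * y₋ + y₊)
        ≈⟨ solve 4 (λ x k y z → x :* (k :* y :+ z) := x :* z :+ k :* (x :* y)) ≈-refl (x zero) k y₋ y₊ ⟩
      x zero * y₊ + k * (x zero * y₋)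
        ≈⟨ +-cong S-last-scaled (*-congˡ (S-inject₁-scaled (Fin.fromℕ r))) ⟩
      1# - k * last x + k * last x        ≈⟨ x-y+y≈x 1# (k * last x) ⟩
      1#                                  ∎
      where
      k  = fromℕ (digit x)
      y₋ = ext (S x) (penultCol r)
      y₊ = ext (S x) (lastCol r)

  -- Multiply 1/xₙ < 1 + k by xₙ. This places the new last coordinate of `S x` below the one before
  -- it.
  1-kxₙ≤xₙ : ∀ {r} {x : Vector Carrier (suc r)} → 0# < last x →
             1# - fromℕ (digit x) * last x ≤ last x
  1-kxₙ≤xₙ {x = x} 0<xₙ = +-cancelʳ-≤ (k * last x) (begin
    1# - k * last x + k * last x  ≈⟨ x-y+y≈x 1# (k * last x) ⟩
    1#                            ≈⟨ ⁻¹-inverseʳ (last x) (<⇒≉0 0<xₙ) ⟨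
    last x * last x ⁻¹
      ≤⟨ *-monoˡ-≤ (proj₁ 0<xₙ) (proj₁ (proj₂ (digit-floor {x = x} 0<xₙ))) ⟩
    last x * (1# + k)             ≈⟨ distribˡ (last x) 1# k ⟩
    last x * 1# + last x * k      ≈⟨ +-cong (*-identityʳ (last x)) (*-comm (last x) k) ⟩
    last x + k * last x           ∎)
    where k = fromℕ (digit x)

  -- Once the denominator x₁ is cleared, every inequality but the last is one for x, moved by one
  -- index; the last is `1-kxₙ≤xₙ`.
  S-decreasing : ∀ {r} {x : Vector Carrier (suc r)} → Decreasing x → 0# < last x → Decreasing (S x)
  S-decreasing {r} {x} dec 0<xₙ j = *-cancelˡ-≤ 0<x₁ (scaled (view j))
    where
    0<x₁ : 0# < x zero
    0<x₁ = ext-positive dec 0<xₙ (suc zero)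
    scaled : ∀ {j} → View j → x zero * ext (S x) (suc j) ≤ x zero * ext (S x) (inject₁ j)
    scaled (‵inject₁ i) = begin
      x zero * ext (S x) (inject₁ (suc i))      ≈⟨ S-inject₁-scaled x 0<x₁ (suc i) ⟩
      ext x (suc (suc i))                       ≤⟨ dec (suc i) ⟩
      ext x (suc (inject₁ i))                   ≈⟨ S-inject₁-scaled x 0<x₁ (inject₁ i) ⟨
      x zero * ext (S x) (inject₁ (inject₁ i))  ∎
    scaled ‵fromℕ = begin
      x zero * last (S x)                       ≈⟨ S-last-scaled x 0<x₁ ⟩
      1# - fromℕ (digit x) * last x             ≤⟨ 1-kxₙ≤xₙ {x = x} 0<xₙ ⟩
      last x                                    ≈⟨ S-inject₁-scaled x 0<x₁ (Fin.fromℕ r) ⟨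
      x zero * ext (S x) (penultCol r)          ∎

  -- Orbits with infinite expansion

  module Orbit {r} (x : Vector Carrier (suc r)) (x∈B : InB x) (infinite : InfiniteExpansion x) where

    X : ℕ → Vector Carrier (suc (suc r))
    X s = ext (S^ s x)

    d : ℕ → ℕ
    d s = digit (S^ s x)

    S^-suc : ∀ s → S^ (suc s) x ≡ S (S^ s x)
    S^-suc = iterate-suc S x

    S^-decreasing : ∀ s → Decreasing (S^ s x)
    S^-decreasing zero = InB⇒Decreasing x∈B
    S^-decreasing (suc s) rewrite S^-suc s = S-decreasing (S^-decreasing s) (infinite s)

    X≤1 : ∀ s l → X s l ≤ 1#
    X≤1 s = ext≤1 (S^-decreasing s)

    X-positive : ∀ s l → 0# < X s l
    X-positive s = ext-positive (S^-decreasing s) (infinite s)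

    1≤d : ∀ s → 1 ℕ.≤ d s
    1≤d s = 1≤digit {x = S^ s x} (infinite s) (X≤1 s (lastCol r))

    -- By associativity the digit matrix moves from D to X, where `β-ext` turns X at time s + 1 into
    -- X at time s, up to the first coordinate. This factor is positive, so orthogonality
    -- propagates.
    trajectory-∙ : ∀ {D} → IsTrajectory d D → ∀ s → S^ s x zero * (D (suc s) ∙ X (suc s)) ≈ D s ∙ X s
    trajectory-∙ {D} trD s rewrite S^-suc s = begin-equality
      z * (D (suc s) ∙ Y)
        ≈⟨ *-congˡ (∙-cong {w = Y} (trD s) λ _ → ≈-refl) ⟩
      z * ((λ j → D s ∙ λ l → b l j) ∙ Y)                 ≈⟨ *-congˡ (∙-assoc (D s) b Y) ⟩
      z * (D s ∙ λ l → b l ∙ Y)                           ≈⟨ ∙-scaleʳ z (D s) (λ l → b l ∙ Y) ⟨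
      (D s ∙ λ l → z * (b l ∙ Y))
        ≈⟨ ∙-cong {v = D s} (λ _ → ≈-refl) (β-ext (S^ s x) (X-positive s (suc zero))) ⟩
      D s ∙ X s                                           ∎
      where
      z = S^ s x zero
      Y = ext (S (S^ s x))
      b : Fin (suc (suc r)) → Vector Carrier (suc (suc r))
      b l j = fromℕ (β (d s) l j)

    trajectory-orthogonal : ∀ {D} → IsTrajectory d D → D 0 ∙ X 0 ≈ 0# → ∀ s → D s ∙ X s ≈ 0#
    trajectory-orthogonal trD D∙X≈0 zero    = D∙X≈0
    trajectory-orthogonal {D} trD D∙X≈0 (suc s) = *-cancelˡ-≈ (<⇒≉0 (X-positive s (suc zero))) (begin-equality
      S^ s x zero * (D (suc s) ∙ X (suc s)) ≈⟨ trajectory-∙ {D} trD s ⟩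
      D s ∙ X s                             ≈⟨ trajectory-orthogonal {D} trD D∙X≈0 s ⟩
      0#                                    ≈⟨ zeroʳ _ ⟨
      S^ s x zero * 0#                      ∎)

  -- Eventually periodic expansions

  module Periodic {r} (x : Vector Carrier (suc r)) (x∈B : InB x) (infinite : InfiniteExpansion x)
                  (m p : ℕ) (1≤p : 1 ℕ.≤ p) (period : ∀ i → S^ (m ℕ.+ p) x i ≈ S^ m x i) where
    open Orbit x x∈B infinite

    periodic₁ : ∀ t i → S^ (t ℕ.+ (m ℕ.+ p)) x i ≈ S^ (t ℕ.+ m) x i
    periodic₁ zero = period
    periodic₁ (suc t) i rewrite S^-suc (t ℕ.+ (m ℕ.+ p)) | S^-suc (t ℕ.+ m) =
      S-cong {x = S^ (t ℕ.+ (m ℕ.+ p)) x} {S^ (t ℕ.+ m) x}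
             (infinite (t ℕ.+ (m ℕ.+ p))) (infinite (t ℕ.+ m)) (periodic₁ t) i

    periodic : ∀ q t i → S^ (q ℕ.* p ℕ.+ (t ℕ.+ m)) x i ≈ S^ (t ℕ.+ m) x i
    periodic zero    t i = ≈-refl
    periodic (suc q) t i = begin-equality
      S^ (suc q ℕ.* p ℕ.+ (t ℕ.+ m)) x i
        ≡⟨ ≡.cong (λ s → S^ s x i) (rearrange p (q ℕ.* p) t m) ⟩
      S^ (q ℕ.* p ℕ.+ t ℕ.+ (m ℕ.+ p)) x i   ≈⟨ periodic₁ (q ℕ.* p ℕ.+ t) i ⟩
      S^ (q ℕ.* p ℕ.+ t ℕ.+ m) x i           ≡⟨ ≡.cong (λ s → S^ s x i) (ℕ.+-assoc (q ℕ.* p) t m) ⟩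
      S^ (q ℕ.* p ℕ.+ (t ℕ.+ m)) x i         ≈⟨ periodic q t i ⟩
      S^ (t ℕ.+ m) x i                       ∎
      where
      rearrange : ∀ p w t m → p ℕ.+ w ℕ.+ (t ℕ.+ m) ≡ w ℕ.+ t ℕ.+ (m ℕ.+ p)
      rearrange = solve-∀

    d-periodic : ∀ q t → d (q ℕ.* p ℕ.+ (t ℕ.+ m)) ≡ d (t ℕ.+ m)
    d-periodic q t = digit-cong {x = S^ (q ℕ.* p ℕ.+ (t ℕ.+ m)) x} {S^ (t ℕ.+ m) x}
      (infinite (q ℕ.* p ℕ.+ (t ℕ.+ m))) (infinite (t ℕ.+ m)) (periodic q t (Fin.fromℕ r))

    -- L is a multiple of the period and, because 1 ≤ p, at least T, so that a product of L digit
    -- matrices is positive.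
    T L : ℕ
    T = primitivity (suc r)
    L = T ℕ.* p

    T≤L : T ℕ.≤ L
    T≤L = ℕ.≤-trans (ℕ.≤-reflexive (≡.sym (ℕ.*-identityʳ T))) (ℕ.*-monoʳ-≤ T 1≤p)

    -- The start T + m lies past the preperiod m, and also past T, from where on the rows of β⁽ˢ⁾
    -- are positive.
    time : ℕ → ℕ
    time zero    = T ℕ.+ m
    time (suc t) = time t ℕ.+ L

    time≡ : ∀ t i → time t ℕ.+ i ≡ t ℕ.* T ℕ.* p ℕ.+ (T ℕ.+ i ℕ.+ m)
    time≡ zero    i = rearrange T m i
      where
      rearrange : ∀ T m i → T ℕ.+ m ℕ.+ i ≡ T ℕ.+ i ℕ.+ m
      rearrange = solve-∀
    time≡ (suc t) i = ≡.trans (ℕ.+-assoc (time t) L i) (≡.trans (time≡ t (L ℕ.+ i)) (rearrange t T p i m))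
      where
      rearrange : ∀ t T p i m → t ℕ.* T ℕ.* p ℕ.+ (T ℕ.+ (T ℕ.* p ℕ.+ i) ℕ.+ m) ≡
                                (T ℕ.+ t ℕ.* T) ℕ.* p ℕ.+ (T ℕ.+ i ℕ.+ m)
      rearrange = solve-∀

    T≤time : ∀ t → T ℕ.≤ time t
    T≤time zero    = ℕ.m≤m+n T m
    T≤time (suc t) = ℕ.≤-trans (T≤time t) (ℕ.m≤m+n (time t) L)

    X-time : ∀ t l → X (time t) l ≈ X (time 0) l
    X-time t zero    = ≈-refl
    X-time t (suc i) = begin-equality
      S^ (time t) x i                               ≡⟨ ≡.cong (λ s → S^ s x i) time-t≡ ⟩
      S^ (t ℕ.* T ℕ.* p ℕ.+ (T ℕ.+ m)) x i          ≈⟨ periodic (t ℕ.* T) T i ⟩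
      S^ (T ℕ.+ m) x i                              ∎
      where
      time-t≡ : time t ≡ t ℕ.* T ℕ.* p ℕ.+ (T ℕ.+ m)
      time-t≡ = ≡.trans (≡.sym (ℕ.+-identityʳ (time t))) (≡.trans (time≡ t 0)
        (≡.cong (λ u → t ℕ.* T ℕ.* p ℕ.+ (u ℕ.+ m)) (ℕ.+-identityʳ T)))

    d-time : ∀ t i → d (time t ℕ.+ i) ≡ d (time 0 ℕ.+ i)
    d-time t i = ≡.trans (≡.cong d (time≡ t i)) (≡.trans (d-periodic (t ℕ.* T) (T ℕ.+ i))
      (≡.sym (≡.cong d (time≡ 0 i))))

    block : ℕ → Matrix (suc (suc r))
    block t = β-product (λ i → d (time t ℕ.+ i)) L

    block-time : ∀ t l j → block t l j ≡ block 0 l j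
    block-time t = β-product-cong (d-time t) L

    -- The number 1 separates the two sides: coordinates in X are at most 1, while entries of the
    -- block are positive integers.
    X≤block : ∀ t l j → X (time t) l ≤ fromℕ (block t l j)
    X≤block t l j = ≤-trans (X≤1 (time t) l)
      (1≤fromℕ (β-product-positive (λ i → d (time t ℕ.+ i)) (λ i → 1≤d (time t ℕ.+ i)) L T≤L l j))

    multiple-X-mono : ∀ l {m n} → m ℕ.≤ n → fromℕ m * X (time 0) l ≤ fromℕ n * X (time 0) l
    multiple-X-mono l m≤n = *-monoʳ-≤ (proj₁ (X-positive (time 0) l)) (fromℕ-mono-≤ m≤n)

    -- X is positive, so the Archimedean property gives a multiple for each entry; `uniform` is used
    -- over columns and then over rows.
    block≤multiple-X₀ : ∃ λ k → ∀ l j → fromℕ (block 0 l j) ≤ fromℕ k * X (time 0) l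
    block≤multiple-X₀ =
      uniform (λ l m≤n b j → ≤-trans (b j) (multiple-X-mono l m≤n)) λ l →
      uniform (λ j m≤n b → ≤-trans b (multiple-X-mono l m≤n)) λ j →
      let n , <n = archimedean-* (fromℕ (block 0 l j)) (X-positive (time 0) l) in n , proj₁ <n

    block≤multiple-X : ∃ λ k → 1 ℕ.≤ k × (∀ t l j → fromℕ (block t l j) ≤ fromℕ (suc k) * X (time t) l)
    -- The successor ensures the condition 1 ≤ k of `harmonic-step`. Periodicity makes one constant
    -- valid for all t.
    block≤multiple-X = let k , bound = block≤multiple-X₀ in suc k , s≤s z≤n , λ t l j → begin
      fromℕ (block t l j)                 ≡⟨ ≡.cong fromℕ (block-time t l j) ⟩
      fromℕ (block 0 l j)                 ≤⟨ bound l j ⟩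
      fromℕ k * X (time 0) l              ≤⟨ multiple-X-mono l (ℕ.m≤n+m k 2) ⟩
      fromℕ (suc (suc k)) * X (time 0) l  ≈⟨ *-congˡ (X-time t l) ⟨
      fromℕ (suc (suc k)) * X (time t) l  ∎

    B : ℕ → Vector Carrier (suc (suc r))
    B = row d zero

    B-positive : ∀ s → T ℕ.≤ s → ∀ g → 0# < B s g
    B-positive s T≤s g = 0<fromℕ (β-product-positive d 1≤d s T≤s zero g)

    -- Decay of trajectories orthogonal to the orbit

    module _ {D : ℕ → Vector Carrier (suc (suc r))} (trD : IsTrajectory d D)
             (D∙X≈0 : D 0 ∙ X 0 ≈ 0#) where

      private
        k : ℕ
        k = proj₁ block≤multiple-X

      initial-bound : ∃ λ C → ∀ g → fromℕ k * D (time 0) g ≤ fromℕ C * B (time 0) g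
      initial-bound = uniform
        (λ g m≤n b → ≤-trans b (*-monoʳ-≤ (fromℕ-nonneg (β-product d (time 0) zero g)) (fromℕ-mono-≤ m≤n)))
        (λ g → let n , <n = archimedean-* (fromℕ k * D (time 0) g) (B-positive (time 0) (ℕ.m≤m+n T m) g)
               in n , proj₁ <n)

      private
        C : ℕ
        C = proj₁ initial-bound

      -- Each block combines `contraction` with `harmonic-step`. The offset k in the multiplier
      -- makes the requirement k ≤ t + k hold from the first block on.
      decay : ∀ t g → fromℕ (t ℕ.+ k) * D (time t) g ≤ fromℕ C * B (time t) g
      decay zero    = proj₂ initial-bound
      decay (suc t) g = begin
        fromℕ (suc (t ℕ.+ k)) * D (time (suc t)) g
          ≈⟨ *-congˡ (trajectory-block d {D} trD (time t) L g) ⟩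
        fromℕ (suc (t ℕ.+ k)) * (D (time t) ∙ P)
          ≤⟨ harmonic-step {k} {t ℕ.+ k} 1≤k (ℕ.m≤n+m k t) 0≤CBP contracted ⟩
        fromℕ C * (B (time t) ∙ P)
          ≈⟨ *-congˡ (trajectory-block d {B} (row-isTrajectory d zero) (time t) L g) ⟨
        fromℕ C * B (time (suc t)) g                   ∎
        where
        P : Vector Carrier (suc (suc r))
        P l = fromℕ (block t l g)
        1≤k : 1 ℕ.≤ k
        1≤k = proj₁ (proj₂ block≤multiple-X)
        0≤CBP : 0# ≤ fromℕ C * (B (time t) ∙ P)
        0≤CBP = ≤-trans (*-nonneg (fromℕ-nonneg C) (fromℕ-nonneg (β-product d (time (suc t)) zero g)))
          (≤-reflexive (*-congˡ (trajectory-block d {B} (row-isTrajectory d zero) (time t) L g)))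
        contracted : fromℕ (suc k) * (fromℕ (t ℕ.+ k) * (D (time t) ∙ P)) ≤ fromℕ k * (fromℕ C * (B (time t) ∙ P))
        contracted = contraction P {k} (X (time t)) (B (time t)) (D (time t))
          (λ l → X≤block t l g) (λ l → proj₂ (proj₂ block≤multiple-X) t l g)
          (λ l → fromℕ-nonneg (β-product d (time t) zero l))
          (trajectory-orthogonal {D} trD D∙X≈0 (time t)) (fromℕ-nonneg C) (decay t)

      negligible : ∀ ε → 0# < ε → ∃ λ N → ∀ s → N ℕ.≤ s → ∀ g → D s g < B s g * ε
      negligible ε 0<ε =
        -- With C < t ε, the bound at `time t`, carried on to any later s, gives (t + k) D ≤ C B < t
        -- ε B ≤ (t + k) ε B.
        let t , C<tε = archimedean-* (fromℕ C) 0<ε in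
        time t , λ s time≤s g → *-cancelˡ-< (fromℕ-nonneg (t ℕ.+ k)) (begin-strict
          fromℕ (t ℕ.+ k) * D s g           ≤⟨ later t s time≤s g ⟩
          fromℕ C * B s g                   ≈⟨ *-comm (fromℕ C) (B s g) ⟩
          B s g * fromℕ C
            <⟨ *-monoˡ-< (B-positive s (ℕ.≤-trans (T≤time t) time≤s) g) C<tε ⟩
          B s g * (fromℕ t * ε)
            ≈⟨ solve 3 (λ b t e → b :* (t :* e) := t :* (b :* e)) ≈-refl (B s g) (fromℕ t) ε ⟩
          fromℕ t * (B s g * ε)
            ≤⟨ *-monoʳ-≤ (*-nonneg (fromℕ-nonneg (β-product d s zero g)) (proj₁ 0<ε)) (fromℕ-mono-≤ (ℕ.m≤m+n t k)) ⟩
          fromℕ (t ℕ.+ k) * (B s g * ε)     ∎)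
        where
        later : ∀ t s → time t ℕ.≤ s → ∀ g → fromℕ (t ℕ.+ k) * D s g ≤ fromℕ C * B s g
        later t s time≤s = ≡.subst (λ s → ∀ g → fromℕ (t ℕ.+ k) * D s g ≤ fromℕ C * B s g) (ℕ.m∸n+n≡m time≤s)
          (trajectory-mono d {D} {B} trD (row-isTrajectory d zero) (s ℕ.∸ time t) (time t) (decay t))

    module _ (u : Carrier) (i : Fin (suc r)) where

      -- This is u (B_ig - x_i B_0g). As `negligible` bounds from above only, u = 1 and u = -1 are
      -- used for the two sides.
      deviation : ℕ → Vector Carrier (suc (suc r))
      deviation s g = u * row d (suc i) s g + u * - x i * B s g

      deviation-isTrajectory : IsTrajectory d deviation
      deviation-isTrajectory = linear-isTrajectory d u (u * - x i) {row d (suc i)} {B}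
        (row-isTrajectory d (suc i)) (row-isTrajectory d zero)

      -- β⁽⁰⁾ is the identity, so its rows pick out the coordinates of (1, x), and what remains is u
      -- (x_i - x_i).
      deviation-orthogonal : deviation 0 ∙ X 0 ≈ 0#
      deviation-orthogonal = begin-equality
        deviation 0 ∙ X 0
          ≈⟨ ∙-linearˡ u (u * - x i) (row d (suc i) 0) (B 0) (X 0) ⟩
        u * (row d (suc i) 0 ∙ X 0) + u * - x i * (B 0 ∙ X 0)
          ≈⟨ +-cong (*-congˡ (identity-∙ (X 0) (suc i))) (*-congˡ (identity-∙ (X 0) zero)) ⟩
        u * x i + u * - x i * 1#                                    ≈⟨ +-congˡ (*-identityʳ _) ⟩
        u * x i + u * - x i                                         ≈⟨ distribˡ u (x i) (- x i) ⟨
        u * (x i - x i)                                             ≈⟨ *-congˡ (-‿inverseʳ (x i)) ⟩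
        u * 0#                                                      ≈⟨ zeroʳ u ⟩
        0#                                                          ∎

      ratio-bound : ∀ ε → 0# < ε → ∃ λ N → ∀ s → N ℕ.≤ s → ∀ g →
                    u * (row d (suc i) s g / B s g - x i) < ε
      ratio-bound ε 0<ε =
        let N , small = negligible {deviation} deviation-isTrajectory deviation-orthogonal ε 0<ε in
        -- T is added so that the denominator B_0g is positive and can be cleared.
        N ℕ.+ T , λ s N+T≤s g →
          let b = B s g
              q = row d (suc i) s g / b
              0<b = B-positive s (ℕ.≤-trans (ℕ.m≤n+m T N) N+T≤s) g
          in *-cancelˡ-< (proj₁ 0<b) (begin-strict
            b * (u * (q - x i))
              ≈⟨ solve 4 (λ b u q y → b :* (u :* (q :+ y)) := u :* (b :* q) :+ u :* y :* b) ≈-refl b u q (- x i) ⟩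
            u * (b * q) + u * - x i * b
              ≈⟨ +-congʳ (*-congˡ (x*[y/x]≈y (row d (suc i) s g) (<⇒≉0 0<b))) ⟩
            deviation s g                   <⟨ small s (ℕ.≤-trans (ℕ.m≤m+n N T) N+T≤s) g ⟩
            b * ε                           ∎)

    ratio-converges : ∀ ε → 0# < ε → ∀ g i →
                      ∃ λ N → ∀ s → N ℕ.≤ s → ∣ row d (suc i) s g / B s g - x i ∣ < ε
    ratio-converges ε 0<ε g i =
      let M , upper = ratio-bound 1# i ε 0<ε
          N , lower = ratio-bound (- 1#) i ε 0<ε
      in M ℕ.+ N , λ s M+N≤s → ∣∣-<
        (≤-<-trans (≤-reflexive (≈-sym (*-identityˡ _))) (upper s (ℕ.≤-trans (ℕ.m≤m+n M N) M+N≤s) g))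
        (≤-<-trans (≤-reflexive (≈-sym (-1*x≈-x _))) (lower s (ℕ.≤-trans (ℕ.m≤n+m N M) M+N≤s) g))

    uniformlyWeaklyConvergent : UniformlyWeaklyConvergent x
    uniformlyWeaklyConvergent g =
      (T , λ s T≤s → ℕ.m<n⇒n≢0 (β-product-positive d 1≤d s T≤s zero g)) ,
      λ ε 0<ε →
        -- Convergence in the maximum norm asks for one threshold for all coordinates.
        let N , close = uniform (λ i m≤n P s n≤s → P s (ℕ.≤-trans m≤n n≤s)) (ratio-converges ε 0<ε g)
        in N , λ s N≤s i → close i s N≤s

mainTheorem5 : ∀ {c ℓ₁ ℓ₂} (ℝ : RealField c ℓ₁ ℓ₂) →
    let open RealField ℝ using (Carrier)
        open Selmer ℝ
    in
    (r : ℕ) (x : Vector Carrier (suc r)) →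
    InB x →
    EventuallyPeriodic x →
    WeaklyConvergent x × UniformlyWeaklyConvergent x
mainTheorem5 ℝ r x x∈B (infinite , m , p , 1≤p , period) =
  uniformlyWeaklyConvergent (penultCol r) , uniformlyWeaklyConvergent
  where open SelmerProperties.Periodic ℝ x x∈B infinite m p 1≤p period
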